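{- Let $s\geq 2$ be an even integer, let $m\geq 3$ be an integer, and let $n$ be an integer with $n\geq (2sm-1)\left(\frac{sm}{2}-1\right)+1$. Then $$R(P_n,J_{s,m})=n+\frac{sm}{2}-1.$$
   Context: All graphs are finite and simple. For graphs $G$ and $H$, the Ramsey number $R(G,H)$ is the least natural number $N$ such that for every graph $F$ on $N$ vertices, either $F$ contains $G$ as a subgraph or the complement $\overline{F}$ contains $H$ as a subgraph. $P_n$ denotes the path on $n$ vertices. For integers $s,m\geq 2$, the generalized Jahangir graph $J_{s,m}$ is the graph on $sm+1$ vertices consisting of a cycle $C_{sm}=v_1v_2\cdots v_{sm}v_1$ together with one additional vertex adjacent to exactly the $m$ cycle vertices $v_1, v_{s+1}, v_{2s+1},\ldots,v_{(m-1)s+1}$ (i.e., $m$ vertices of the cycle at distance $s$ from each other along the cycle). -}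

module Defs where

open import Data.Empty using (⊥)
open import Data.Fin using (Fin; zero; suc; toℕ)
open import Data.Fin.Properties using (any?) renaming (_≟_ to _≟ᶠ_)
open import Data.Nat using (ℕ; suc; _*_; _≤_; _≟_)
open import Data.Product using (_×_; _,_; ∃; ∃-syntax)
open import Data.Sum using (_⊎_; swap)
open import Function.Base using (_∘_)
open import Function.Definitions using (Injective)
open import Level using (0ℓ)
open import Relation.Binary.Core using (Rel)
open import Relation.Binary.Definitions using (Symmetric; Decidable)
open import Relation.Binary.PropositionalEquality using (_≡_; _≢_; refl; sym)
open import Relation.Nullary using (¬_; Dec; no)
open import Relation.Nullary.Decidable using (_×-dec_; _⊎-dec_; ¬?)

-- Adjacency is required to be decidable: this is what makes a finite graph
-- constructively a finite object, so that subgraph containment is decidable.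
record Graph (n : ℕ) : Set₁ where
  field
    Adj        : Rel (Fin n) 0ℓ
    symmetric  : Symmetric Adj
    loopless   : ∀ {i} → ¬ Adj i i
    adjacent?  : Decidable Adj

open Graph public

complement : ∀ {n} → Graph n → Graph n
complement G = record
  { Adj       = λ i j → i ≢ j × ¬ Adj G i j
  ; symmetric = λ (i≢j , ¬ij) → i≢j ∘ sym , ¬ij ∘ symmetric G
  ; loopless  = λ (i≢i , _) → i≢i refl
  ; adjacent? = λ i j → ¬? (i ≟ᶠ j) ×-dec ¬? (adjacent? G i j)
  }

-- F contains G as a (not necessarily induced) subgraph.
_Contains_ : ∀ {n k} → Graph n → Graph k → Set
_Contains_ {n} {k} F G =
  ∃[ f ] Injective {A = Fin k} {B = Fin n} _≡_ _≡_ f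
       × (∀ {i j} → Adj G i j → Adj F (f i) (f j))

RamseyProperty : ∀ {k l} → Graph k → Graph l → ℕ → Set₁
RamseyProperty G H N =
  (F : Graph N) → (F Contains G) ⊎ (complement F Contains H)

-- R(G , H) = N.
IsRamseyNumber : ∀ {k l} → Graph k → Graph l → ℕ → Set₁
IsRamseyNumber G H N =
  RamseyProperty G H N × (∀ M → RamseyProperty G H M → N ≤ M)

-- The simple graph whose edges are the pairs of distinct vertices related by R
-- in at least one direction.
fromRel : ∀ {n} {R : Rel (Fin n) 0ℓ} → Decidable R → Graph n
fromRel {R = R} R? = record
  { Adj       = λ i j → i ≢ j × (R i j ⊎ R j i)
  ; symmetric = λ (i≢j , e) → i≢j ∘ sym , swap e
  ; loopless  = λ (i≢i , _) → i≢i refl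
  ; adjacent? = λ i j → ¬? (i ≟ᶠ j) ×-dec (R? i j ⊎-dec R? j i)
  }

path : ∀ n → Graph n
path n = fromRel {R = λ i j → toℕ j ≡ suc (toℕ i)}
                 (λ i j → toℕ j ≟ suc (toℕ i))

-- The cycle on k vertices when k ≥ 3; smaller k give a degenerate simple graph.
cycle : ∀ k → Graph k
cycle k = fromRel
  {R = λ i j → toℕ j ≡ suc (toℕ i) ⊎ (suc (toℕ i) ≡ k × toℕ j ≡ 0)}
  (λ i j → (toℕ j ≟ suc (toℕ i)) ⊎-dec ((suc (toℕ i) ≟ k) ×-dec (toℕ j ≟ 0)))

-- Vertex zero is the additional vertex, and suc i is the cycle vertex v_{i+1}
-- (cycle indices start at 0 here), so its neighbours v_{ks+1}, 0 ≤ k < m,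
-- are those with i = k s.
module Jahangir (s m : ℕ) where

  Spoke : Fin (s * m) → Set
  Spoke i = ∃ λ (k : Fin m) → toℕ i ≡ toℕ k * s

  spoke? : ∀ i → Dec (Spoke i)
  spoke? i = any? λ k → toℕ i ≟ toℕ k * s

  JAdj : Rel (Fin (suc (s * m))) 0ℓ
  JAdj zero    zero    = ⊥
  JAdj zero    (suc j) = Spoke j
  JAdj (suc i) zero    = Spoke i
  JAdj (suc i) (suc j) = Adj (cycle (s * m)) i j

  JAdj-sym : Symmetric JAdj
  JAdj-sym {zero}  {suc j} e = e
  JAdj-sym {suc i} {zero}  e = e
  JAdj-sym {suc i} {suc j} e = symmetric (cycle (s * m)) e

  JAdj-loopless : ∀ {i} → ¬ JAdj i i
  JAdj-loopless {suc i} e = loopless (cycle (s * m)) e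

  JAdj? : Decidable JAdj
  JAdj? zero    zero    = no λ ()
  JAdj? zero    (suc j) = spoke? j
  JAdj? (suc i) zero    = spoke? i
  JAdj? (suc i) (suc j) = adjacent? (cycle (s * m)) i j

jahangir : ∀ s m → Graph (suc (s * m))
jahangir s m = record
  { Adj       = JAdj
  ; symmetric = λ {i} {j} → JAdj-sym {i} {j}
  ; loopless  = λ {i} → JAdj-loopless {i}
  ; adjacent? = JAdj?
  }
  where open Jahangir s m

{-# OPTIONS --safe #-}
module Submission where

-- Write k = s m / 2.  As s is even, J = J_{s,m} is a subgraph of K_{k,k+1} (numbering the
-- hub 0 and the cycle vertices 1, …, 2k, every edge joins numbers of opposite parity), and
-- the cycle contains a matching of k edges.
--
-- Lower bound: K_{n-1} ∪ K_{k-1} has no P_n, and each of the k matching edges of a copy of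
-- J in its complement would need its own vertex of K_{k-1}.
--
-- Upper bound, on n + k - 1 vertices: depth-first search finds a path on
-- k(2k-1) + k + 1 vertices or a K_{k,k+1} in the complement.  Let P be a path with at least
-- this many but fewer than n vertices, and z a vertex off P.  If P + z is not traceable,
-- then z and the successors on P of its neighbours form an independent set; so either the
-- complement contains K_{2k+1}, or z has at most 2k-1 neighbours on P.  In the latter case
-- for all z, any k vertices off P have k+1 common non-neighbours on P.

open import Defs
open import Data.Fin using (Fin; zero; suc; toℕ; fromℕ<; inject≤; inject₁; cast; combine)
  renaming (_≟_ to _≟ᶠ_)
open import Data.Fin.Induction using (<-weakInduction)
open import Data.Fin.Properties using
  ( injective⇒≤; toℕ<n; toℕ-injective; toℕ-inject₁; toℕ-inject≤; inject≤-injective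
  ; toℕ-fromℕ<; toℕ-cast; toℕ-combine; combine-injectiveˡ)
  renaming (suc-injective to sucᶠ-injective)
open import Data.List using
  (List; []; _∷_; _++_; [_]; length; lookup; filter; take; allFin)
open import Data.List.Properties using
  (++-assoc; length-++; ++-identityʳ; length-take; length-tabulate)
open import Data.List.Membership.Propositional using (_∈_; find)
open import Data.List.Membership.Propositional.Properties using (∈-∃++; ∈-lookup)
open import Data.List.Relation.Binary.Permutation.Propositional using
  (_↭_; ↭-refl; ↭-sym; ↭-trans; ↭-prep; ↭-reflexive; ↭⇒↭ₛ)
open import Data.List.Relation.Binary.Permutation.Propositional.Properties using
  (All-resp-↭; ↭-length; shift; ∷↭∷ʳ; ++-comm; ++⁺ˡ; ++⁺ʳ)
import Data.List.Relation.Binary.Permutation.Setoid.Properties as Permutationₛ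
open import Data.List.Relation.Binary.Sublist.Propositional using
  (_⊆_; []; _∷_; _∷ʳ_; ⊆-refl; ⊆-trans)
open import Data.List.Relation.Binary.Sublist.Propositional.Properties using
  (All-resp-⊆; filter-⊆; filter⁺; length-mono-≤; take-⊆)
  renaming (++⁺ to ⊆-++⁺; ++⁺ˡ to ⊆-++⁺ˡ; ++⁺ʳ to ⊆-++⁺ʳ)
open import Data.List.Relation.Unary.All as All using (All; []; _∷_)
open import Data.List.Relation.Unary.All.Properties using
  (¬Any⇒All¬; all-filter; ++⁻) renaming (take⁺ to All-take⁺)
open import Data.List.Relation.Unary.AllPairs using (AllPairs; []; _∷_)
open import Data.List.Relation.Unary.Any using (any?)
open import Data.List.Relation.Unary.Unique.Propositional using (Unique)
open import Data.List.Relation.Unary.Unique.Propositional.Properties using (allFin⁺)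
open import Data.Nat using
  ( ℕ; zero; suc; pred; _+_; _*_; _∸_; _≤_; _<_; _≥_; z≤n; s≤s; s≤s⁻¹
  ; _≟_; _<?_; _≤?_; parity)
open import Data.Nat.DivMod using (_/_; m/n*n≡m)
open import Data.Nat.Divisibility using (_∣_; divides; ∣m⇒∣m*n; ∣n⇒∣m*n)
open import Data.Nat.Properties hiding (_≟_; _<?_; _≤?_)
open import Data.Nat.Solver using (module +-*-Solver)
open +-*-Solver using (solve; _:+_; _:*_; _:=_; con)
open import Data.Parity using (Parity; 0ℙ; 1ℙ)
open import Data.Parity.Properties using (suc-homo-⁻¹; *-homo-*; p≢p⁻¹)
  renaming (*-zeroʳ to ℙ-*-zeroʳ)
open import Data.Product using (_×_; _,_; ∃; ∃₂; proj₁; proj₂)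
open import Data.Sum using (_⊎_; inj₁; inj₂; [_,_]′)
  renaming (map₁ to ⊎-map₁; map₂ to ⊎-map₂)
open import Function.Base using (_∘_; id; case_of_)
open import Function.Definitions using (Injective)
open import Level using (0ℓ)
open import Relation.Binary.Core using (Rel)
open import Relation.Binary.Definitions using (Symmetric; Decidable)
open import Relation.Binary.PropositionalEquality using
  (_≡_; _≢_; refl; sym; trans; cong; subst; setoid; ≢-sym)
open import Relation.Nullary using (¬_; Dec; yes; no; contradiction)
open import Relation.Nullary.Decidable using (¬?; _×-dec_; _⊎-dec_)
open import Relation.Unary using (Pred)
import Relation.Unary as Unary

-- Lists: permutations, sublists, interleaving.

module _ {A : Set} where

  Unique-resp-↭ : ∀ {xs ys : List A} → xs ↭ ys → Unique xs → Unique ys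
  Unique-resp-↭ = Permutationₛ.Unique-resp-↭ (setoid A) ∘ ↭⇒↭ₛ

  ∈⇒↭ : ∀ {x} {xs : List A} → x ∈ xs → ∃ λ ys → xs ↭ x ∷ ys
  ∈⇒↭ x∈ with ys , zs , refl ← ∈-∃++ x∈ = ys ++ zs , shift _ ys zs

  AllPairs-resp-⊆ : ∀ {R : Rel A 0ℓ} {xs ys} → xs ⊆ ys → AllPairs R ys → AllPairs R xs
  AllPairs-resp-⊆ []         []         = []
  AllPairs-resp-⊆ (_ ∷ʳ p)   (_  ∷ rss) = AllPairs-resp-⊆ p rss
  AllPairs-resp-⊆ (refl ∷ p) (rs ∷ rss) = All-resp-⊆ p rs ∷ AllPairs-resp-⊆ p rss

  lookup-AllPairs : ∀ {R : Rel A 0ℓ} → Symmetric R → ∀ {xs} → AllPairs R xs →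
                    ∀ i j → i ≢ j → R (lookup xs i) (lookup xs j)
  lookup-AllPairs R-sym (rs ∷ rss) zero    zero    i≢j = contradiction refl i≢j
  lookup-AllPairs R-sym (rs ∷ rss) zero    (suc j) i≢j = All.lookup rs (∈-lookup j)
  lookup-AllPairs R-sym (rs ∷ rss) (suc i) zero    i≢j = R-sym (All.lookup rs (∈-lookup i))
  lookup-AllPairs R-sym (rs ∷ rss) (suc i) (suc j) i≢j =
    lookup-AllPairs R-sym rss i j (i≢j ∘ cong suc)

  lookup-injective : ∀ {xs : List A} → Unique xs → Injective _≡_ _≡_ (lookup xs)
  lookup-injective uniq {i} {j} eq with i ≟ᶠ j
  ... | yes i≡j = i≡j
  ... | no  i≢j = contradiction eq (lookup-AllPairs ≢-sym uniq i j i≢j)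

  length-filter-∁ : ∀ {P : Pred A 0ℓ} (P? : Unary.Decidable P) xs →
                    length (filter P? xs) + length (filter (¬? ∘ P?) xs) ≡ length xs
  length-filter-∁ P? [] = refl
  length-filter-∁ P? (x ∷ xs) with P? x
  ... | yes _ = cong suc (length-filter-∁ P? xs)
  ... | no  _ = trans (+-suc _ _) (cong suc (length-filter-∁ P? xs))

  all-or : ∀ {B : Set} {P : Pred A 0ℓ} {xs} → All (λ x → B ⊎ P x) xs → B ⊎ All P xs
  all-or []            = inj₂ []
  all-or (inj₁ b ∷ _)  = inj₁ b
  all-or (inj₂ p ∷ ps) = ⊎-map₂ (p ∷_) (all-or ps)

  -- Stops as soon as the list whose turn it is runs out.
  interleave : List A → List A → List A
  interleave []       ys = []
  interleave (x ∷ xs) ys = x ∷ interleave ys xs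

  interleave⁺ : ∀ {P : Pred A 0ℓ} {xs ys} → All P xs → All P ys → All P (interleave xs ys)
  interleave⁺ []       qs = []
  interleave⁺ (p ∷ ps) qs = p ∷ interleave⁺ qs ps

  interleave-unique : ∀ xs ys → Unique (xs ++ ys) → Unique (interleave xs ys)
  interleave-unique []       ys _          = []
  interleave-unique (x ∷ xs) ys (rs ∷ rss) =
    let x≢xs , x≢ys = ++⁻ xs rs in
    interleave⁺ x≢ys x≢xs ∷ interleave-unique ys xs (Unique-resp-↭ (++-comm xs ys) rss)

  length-interleave : ∀ k (xs ys : List A) → k ≤ length xs → k ≤ length ys →
                      2 * k ≤ length (interleave xs ys)
  length-interleave zero    xs       ys       _       _       = z≤n
  length-interleave (suc k) (x ∷ xs) (y ∷ ys) (s≤s p) (s≤s q)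
    rewrite +-suc k (k + 0) = s≤s (s≤s (length-interleave k xs ys p q))

  choose : Parity → Pred A 0ℓ → Pred A 0ℓ → Pred A 0ℓ
  choose 0ℙ P Q = P
  choose 1ℙ P Q = Q

  choose-suc : ∀ n {P Q : Pred A 0ℓ} {x} → choose (parity n) Q P x → choose (parity (suc n)) P Q x
  choose-suc zero          q = q
  choose-suc (suc zero)    p = p
  choose-suc (suc (suc n)) r = choose-suc n r

  lookup-interleave : ∀ {P Q : Pred A 0ℓ} {xs ys} → All P xs → All Q ys →
                      ∀ i → choose (parity (toℕ i)) P Q (lookup (interleave xs ys) i)
  lookup-interleave (p ∷ ps) qs zero    = p
  lookup-interleave (p ∷ ps) qs (suc i) = choose-suc (toℕ i) (lookup-interleave qs ps i)

-- Embedding parity-coloured graphs in a complement.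

parity-suc : ∀ n → parity (suc n) ≢ parity n
parity-suc n eq = p≢p⁻¹ _ (trans eq (sym (suc-homo-⁻¹ n)))

-- Bipartiteness with the two-colouring fixed in advance, so that vertex `i` can be sent to position
-- `i` of a list whose sides alternate.
Alternating : ∀ {l} → Graph l → Set
Alternating H = ∀ i j → Adj H i j → parity (toℕ i) ≢ parity (toℕ j)

module InGraph {N} (F : Graph N) where

  V : Set
  V = Fin N

  NonAdj : Rel V 0ℓ
  NonAdj x y = ¬ Adj F x y

  -- The complete bipartite graph lies in the complement of `F`. Sizes are lower bounds because its
  -- producers may leave vertices to spare.
  record Biclique (a b : ℕ) : Set where
    field
      left right : List V
      a≤left     : a ≤ length left
      b≤right    : b ≤ length right
      unique     : Unique (left ++ right)
      nonAdj     : All (λ x → All (NonAdj x) right) left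

  module _ {l k} (H : Graph l) (alt : Alternating H) (l≤1+2k : l ≤ suc (2 * k)) where

    -- Restricting the demand to positions of opposite parity lets one map serve both independent
    -- sets and interleaved bicliques.
    embed : ∀ xs → suc (2 * k) ≤ length xs → Unique xs →
            (∀ i j → parity (toℕ i) ≢ parity (toℕ j) → NonAdj (lookup xs i) (lookup xs j)) →
            complement F Contains H
    embed xs big uniq nonadj = f , f-injective , λ {i} {j} → f-hom i j
      where
      l≤|xs| = ≤-trans l≤1+2k big

      f : Fin l → V
      f i = lookup xs (inject≤ i l≤|xs|)

      f-injective : Injective _≡_ _≡_ f
      f-injective = inject≤-injective l≤|xs| l≤|xs| _ _ ∘ lookup-injective uniq

      f-hom : ∀ i j → Adj H i j → Adj (complement F) (f i) (f j)
      f-hom i j ij =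
        (λ eq → loopless H (subst (Adj H i) (sym (f-injective eq)) ij)) ,
        nonadj _ _ (λ eq → alt i j ij (trans (sym (parity-inject≤ i)) (trans eq (parity-inject≤ j))))
        where
        parity-inject≤ : ∀ i → parity (toℕ (inject≤ i l≤|xs|)) ≡ parity (toℕ i)
        parity-inject≤ i = cong parity (toℕ-inject≤ i l≤|xs|)

    independent⇒contains : ∀ {xs} → suc (2 * k) ≤ length xs → Unique xs → AllPairs NonAdj xs →
                           complement F Contains H
    independent⇒contains big uniq ind = embed _ big uniq λ i j i≢j →
      lookup-AllPairs (λ ¬xy → ¬xy ∘ symmetric F) ind i j (i≢j ∘ cong (parity ∘ toℕ))

    biclique⇒contains : Biclique k (suc k) → complement F Contains H
    biclique⇒contains record { left = xs ; right = [] ; b≤right = () }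
    biclique⇒contains record { left = xs ; right = y ∷ ys ; a≤left = p ; b≤right = s≤s q
                             ; unique = uniq ; nonAdj = nonadj } =
      -- The larger side goes first and takes the positions 0, 2, ..., 2k; splitting off `y` leaves
      -- at least `k` vertices on each side.
      embed (interleave (y ∷ ys) xs) (s≤s (length-interleave k xs ys p q))
        (interleave-unique (y ∷ ys) xs (Unique-resp-↭ (++-comm xs (y ∷ ys)) uniq))
        λ i j → opposite (parity (toℕ i)) (parity (toℕ j)) (side i) (side j)
      where
      side : ∀ i → choose (parity (toℕ i)) (_∈ (y ∷ ys)) (_∈ xs)
                          (lookup (interleave (y ∷ ys) xs) i)
      side = lookup-interleave (All.tabulate id) (All.tabulate id)

      opposite : ∀ p q {u v} → choose p (_∈ (y ∷ ys)) (_∈ xs) u →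
                 choose q (_∈ (y ∷ ys)) (_∈ xs) v → p ≢ q → NonAdj u v
      opposite 0ℙ 0ℙ _  _  p≢q = contradiction refl p≢q
      opposite 0ℙ 1ℙ u∈ v∈ _   = All.lookup (All.lookup nonadj v∈) u∈ ∘ symmetric F
      opposite 1ℙ 0ℙ u∈ v∈ _   = All.lookup (All.lookup nonadj u∈) v∈
      opposite 1ℙ 1ℙ _  _  p≢q = contradiction refl p≢q

  -- Walks, and inserting a vertex into a path.

  -- Walk x ys z visits the vertices x ∷ ys in this order and ends in z.
  data Walk (x : V) : List V → V → Set where
    []  : Walk x [] x
    _∷_ : ∀ {y ys z} → Adj F x y → Walk y ys z → Walk x (y ∷ ys) z

  join : ∀ {a xs b c ys d} → Walk a xs b → Adj F b c → Walk c ys d → Walk a (xs ++ c ∷ ys) d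
  join []      e w′ = e ∷ w′
  join (d ∷ w) e w′ = d ∷ join w e w′

  reverse : ∀ {a xs b} → Walk a xs b → ∃ λ ys → Walk b ys a × b ∷ ys ↭ a ∷ xs
  reverse [] = [] , [] , ↭-refl
  reverse {a} (e ∷ w) =
    let ys , w′ , p = reverse w in
    ys ++ [ a ] , join w′ (symmetric F e) [] ,
    ↭-trans (↭-sym (∷↭∷ʳ a (_ ∷ ys))) (↭-prep a p)

  Traceable : List V → Set
  Traceable xs = ∃₂ λ a ys → ∃ λ b → Walk a ys b × a ∷ ys ↭ xs

  Traceable-resp-↭ : ∀ {xs ys} → xs ↭ ys → Traceable xs → Traceable ys
  Traceable-resp-↭ p (a , ys , b , w , q) = a , ys , b , w , ↭-trans q p

  -- The successors on the walk x ∷ xs of the neighbours of z.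
  succs : V → V → List V → List V
  succs z x []       = []
  succs z x (y ∷ ys) with adjacent? F z x
  ... | yes _ = y ∷ succs z y ys
  ... | no  _ = succs z y ys

  succs-⊆ : ∀ z x xs → succs z x xs ⊆ xs
  succs-⊆ z x []       = []
  succs-⊆ z x (y ∷ ys) with adjacent? F z x
  ... | yes _ = refl ∷ succs-⊆ z y ys
  ... | no  _ = y ∷ʳ succs-⊆ z y ys

  -- Only the end of the walk lacks a successor, and it is not a neighbour of `z`.
  length-succs : ∀ {z x xs e} → Walk x xs e → NonAdj z e →
                 length (filter (adjacent? F z) (x ∷ xs)) ≡ length (succs z x xs)
  length-succs {z} {x} [] ¬ze with adjacent? F z x
  ... | yes zx = contradiction zx ¬ze
  ... | no  _  = refl
  length-succs {z} {x} (_ ∷ w) ¬ze with adjacent? F z x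
  ... | yes _ = cong suc (length-succs w ¬ze)
  ... | no  _ = length-succs w ¬ze

  -- If x ~ z ~ y and moreover the successors h of x and u of y are adjacent, then
  -- … x z y … h u … is a path: the segment from h to y is traversed backwards.
  rotate : ∀ {z a xs x h ms y us e} →
           Walk a xs x → Adj F x z → Walk h ms y → Walk y us e →
           Traceable (z ∷ a ∷ xs ++ h ∷ ms ++ us) ⊎ All (NonAdj h) (succs z y us)
  rotate P xz M [] = inj₂ []
  rotate {z} {a} {xs} {x} {h} {ms} {y} {u ∷ us} P xz M (yu ∷ W)
    with rotate P xz (join M yu []) W
  ... | inj₁ t = inj₁ (subst (λ ls → Traceable (z ∷ a ∷ xs ++ h ∷ ls)) (++-assoc ms [ u ] us) t)
  ... | inj₂ nonadj with adjacent? F z y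
  ...   | no _ = inj₂ nonadj
  ...   | yes zy with adjacent? F h u
  ...     | no ¬hu = inj₂ (¬hu ∷ nonadj)
  ...     | yes hu =
    let rs , M⁻¹ , p = reverse M in
    inj₁ (_ , _ , _ , join P xz (join (zy ∷ M⁻¹) hu W) ,
      ↭-trans (shift z (a ∷ xs) _) (++⁺ˡ (z ∷ a ∷ xs) (++⁺ʳ (u ∷ us) p)))

  -- `P` is the part of the path already passed. If a neighbour of `z` has a successor adjacent to
  -- `z`, then `z` fits between them; two adjacent successors are handled by `rotate`. Otherwise
  -- independence holds.
  insert : ∀ {z a xs x ys e} → Walk a xs x → Walk x ys e →
           Traceable (z ∷ a ∷ xs ++ ys) ⊎ AllPairs NonAdj (z ∷ succs z x ys)
  insert P [] = inj₂ ([] ∷ [])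
  insert {z} {a} {xs} {x} {y ∷ ys} P (xy ∷ W) with insert {z} (join P xy []) W
  ... | inj₁ t = inj₁ (subst (λ ls → Traceable (z ∷ a ∷ ls)) (++-assoc xs [ y ] ys) t)
  ... | inj₂ (zs ∷ rs) with adjacent? F z x
  ...   | no _ = inj₂ (zs ∷ rs)
  ...   | yes zx with adjacent? F z y
  ...     | yes zy = inj₁ (_ , _ , _ , join P (symmetric F zx) (zy ∷ W) , shift z (a ∷ xs) _)
  -- The segment to be reversed starts as the single vertex `y`.
  ...     | no ¬zy with rotate P (symmetric F zx) [] W
  ...       | inj₁ t  = inj₁ t
  ...       | inj₂ ys = inj₂ ((¬zy ∷ zs) ∷ ys ∷ rs)

  -- The one permutation says both that the path repeats no vertex and that `rest` lists exactly the
  -- vertices off it.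
  record Path (q : ℕ) : Set where
    field
      {first last} : V
      tail rest   : List V
      walk        : Walk first tail last
      partition   : first ∷ tail ++ rest ↭ allFin N
      size        : suc (length tail) ≡ q

  length-allFin : ∀ {xs} → xs ↭ allFin N → length xs ≡ N
  length-allFin p = trans (↭-length p) (length-tabulate _)

  unique-allFin : ∀ {xs} → xs ↭ allFin N → Unique xs
  unique-allFin p = Unique-resp-↭ (↭-sym p) (allFin⁺ N)

  lookup-walk : ∀ {a xs b} → Walk a xs b → ∀ i j → toℕ j ≡ suc (toℕ i) →
                Adj F (lookup (a ∷ xs) i) (lookup (a ∷ xs) j)
  lookup-walk (e ∷ w) zero    (suc zero) _  = e
  lookup-walk (e ∷ w) (suc i) (suc j)    eq = lookup-walk w i j (suc-injective eq)

  path⇒contains : ∀ {q} → Path q → F Contains path q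
  path⇒contains {q} record { tail = tail ; rest = rest ; walk = w ; partition = p ; size = refl } =
    lookup (_ ∷ tail) ,
    lookup-injective (AllPairs-resp-⊆ (refl ∷ ⊆-++ tail) (unique-allFin p)) ,
    λ where
      (_ , inj₁ eq) → lookup-walk w _ _ eq
      (_ , inj₂ eq) → symmetric F (lookup-walk w _ _ eq)
    where
    ⊆-++ : ∀ xs → xs ⊆ xs ++ rest
    ⊆-++ xs = ⊆-++⁺ʳ rest ⊆-refl

  -- Depth-first search for a path or a biclique.

  module _ {q k} (1<q : 1 < q) (0<k : 0 < k) (room : q + 2 * k ≤ N) where

    -- Depth-first search: the stack is a path, and no edge joins the vertices
    -- already popped to those not yet visited.
    record State (n : ℕ) (stack unseen done : List V) : Set where
      field
        |unseen|≡n : length unseen ≡ n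
        |stack|<q  : length stack < q
        |done|<k   : length done < k
        partition  : stack ++ unseen ++ done ↭ allFin N
        nonAdj     : All (λ d → All (NonAdj d) unseen) done

    Outcome : Set
    Outcome = Path q ⊎ Biclique k (suc k)

    -- Termination: `push` and `restart` consume an unseen vertex and lower `n`, while `pop` keeps
    -- `n` and shortens the walk. A vertex is popped only when it has no unseen neighbour, and
    -- `unseen` never grows.
    search  : ∀ n {x st e unseen done} → Walk x st e → State n (x ∷ st) unseen done → Outcome
    push    : ∀ n {x st e unseen done y} → Walk x st e → y ∈ unseen → Adj F x y →
              State n (x ∷ st) unseen done → Outcome
    pop     : ∀ n {x st e unseen done} → Walk x st e → All (NonAdj x) unseen →
              State n (x ∷ st) unseen done → Outcome
    restart : ∀ n {unseen done} → State n [] unseen done → Outcome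

    search n {x} {unseen = unseen} w σ with any? (adjacent? F x) unseen
    ... | yes any = let y , y∈ , xy = find any in push n w y∈ xy σ
    ... | no ¬any = pop n w (¬Any⇒All¬ _ ¬any) σ

    push n {x} {st} {done = done} {y} w y∈ xy σ with unseen′ , p ← ∈⇒↭ y∈ =
      cont n (trans (sym (↭-length p)) |unseen|≡n)
      where
      open State σ
      partition′ : (y ∷ x ∷ st) ++ unseen′ ++ done ↭ allFin N
      partition′ = ↭-trans
        (↭-sym (↭-trans (++⁺ˡ (x ∷ st) (++⁺ʳ done p)) (shift y (x ∷ st) _)))
        partition

      cont : ∀ n → suc (length unseen′) ≡ n → Outcome
      cont zero    ()
      cont (suc n) eq with length (y ∷ x ∷ st) ≟ q
      ... | yes size = inj₁ record
        { walk = symmetric F xy ∷ w ; partition = partition′ ; size = size }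
      ... | no size≢q = search n (symmetric F xy ∷ w) record
        { |unseen|≡n = suc-injective eq
        ; |stack|<q  = ≤∧≢⇒< |stack|<q size≢q
        ; |done|<k   = |done|<k
        ; partition  = partition′
        ; nonAdj     = All.map (All.tail ∘ All-resp-↭ p) nonAdj
        }

    pop n {x} {st} {unseen = unseen} {done} w x≁ σ = result (length (x ∷ done) ≟ k)
      where
      open State σ
      partition′ : st ++ unseen ++ x ∷ done ↭ allFin N
      partition′ = ↭-trans (++⁺ˡ st (shift x unseen done))
                           (↭-trans (shift x st (unseen ++ done)) partition)

      -- The stack holds fewer than `q` vertices and `k` are popped, so of at least `q + 2 * k`
      -- vertices more than `k` are unseen.
      enough : ∀ {s u d} → s < q → d ≡ k → s + (u + d) ≡ N → k < u
      enough {s} {u} s<q refl total = +-cancelʳ-< (q + k) k u (begin-strict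
        k + (q + k)  ≡⟨ solve 2 (λ k q → k :+ (q :+ k) := q :+ con 2 :* k) refl k q ⟩
        q + 2 * k    ≤⟨ room ⟩
        N            ≡⟨ total ⟨
        s + (u + k)  <⟨ +-monoˡ-< (u + k) s<q ⟩
        q + (u + k)  ≡⟨ solve 3 (λ k q u → q :+ (u :+ k) := u :+ (q :+ k)) refl k q u ⟩
        u + (q + k)  ∎)
        where open ≤-Reasoning

      cont : ∀ {st e} → Walk x st e → State n st unseen (x ∷ done) → Outcome
      cont []      σ′ = restart n σ′
      cont (_ ∷ w) σ′ = search n w σ′

      result : Dec (length (x ∷ done) ≡ k) → Outcome
      result (yes size) = inj₂ record
        { left = x ∷ done ; right = unseen
        ; a≤left  = ≤-reflexive (sym size)
        ; b≤right = enough (<-trans (n<1+n _) |stack|<q) size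
          (trans (sym (trans (length-++ st) (cong (length st +_) (length-++ unseen))))
                 (length-allFin partition′))
        ; unique  = Unique-resp-↭ (++-comm unseen (x ∷ done))
          (AllPairs-resp-⊆ (⊆-++⁺ˡ st ⊆-refl) (unique-allFin partition′))
        ; nonAdj  = x≁ ∷ nonAdj
        }
      result (no size≢k) = cont w record
        { |unseen|≡n = |unseen|≡n
        ; |stack|<q  = <-trans (n<1+n _) |stack|<q
        ; |done|<k   = ≤∧≢⇒< |done|<k size≢k
        ; partition  = partition′
        ; nonAdj     = x≁ ∷ nonAdj
        }

    -- With nothing stacked or unseen, all `N` vertices would be popped, yet fewer than `k ≤ N` are.
    restart zero    {[]}    {done} σ = contradiction (length-allFin partition) (<⇒≢
      (<-≤-trans |done|<k (≤-trans (m≤m+n k (k + 0)) (≤-trans (m≤n+m (2 * k) q) room))))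
      where open State σ
    restart (suc n) {x ∷ _} σ = search n [] record
      { |unseen|≡n = suc-injective |unseen|≡n
      ; |stack|<q  = 1<q
      ; |done|<k   = |done|<k
      ; partition  = partition
      ; nonAdj     = All.map All.tail nonAdj
      }
      where open State σ

    path-or-biclique : Outcome
    path-or-biclique = restart N record
      { |unseen|≡n = length-tabulate _
      ; |stack|<q  = <-trans (s≤s z≤n) 1<q
      ; |done|<k   = 0<k
      ; partition  = ↭-reflexive (++-identityʳ _)
      ; nonAdj     = []
      }

  -- Lengthening a path vertex by vertex.

  common-nonneighbours :
    ∀ d {xs} zs → All (λ z → length (filter (adjacent? F z) xs) ≤ d) zs →
    ∃ λ ys → ys ⊆ xs × length xs ≤ length ys + length zs * d × All (λ z → All (NonAdj z) ys) zs
  common-nonneighbours d {xs} [] [] = xs , ⊆-refl , m≤m+n _ 0 , []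
  common-nonneighbours d {xs} (z ∷ zs) (few ∷ fews)
    with ys , ys⊆xs , bound , nonadj ← common-nonneighbours d zs fews =
    filter (¬? ∘ z?) ys ,
    ⊆-trans (filter-⊆ _ ys) ys⊆xs ,
    (begin
      length xs                            ≤⟨ bound ⟩
      length ys + length zs * d            ≡⟨ cong (_+ length zs * d) (length-filter-∁ z? ys) ⟨
      near + far + length zs * d           ≤⟨ +-monoˡ-≤ _ (+-monoˡ-≤ far near≤d) ⟩
      d + far + length zs * d              ≡⟨ cong (_+ length zs * d) (+-comm d far) ⟩
      far + d + length zs * d              ≡⟨ +-assoc far d _ ⟩
      far + (d + length zs * d)            ∎) ,
    all-filter (¬? ∘ z?) ys ∷ All.map (All-resp-⊆ (filter-⊆ _ ys)) nonadj
    where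
    open ≤-Reasoning
    z? = adjacent? F z
    near = length (filter z? ys)
    far  = length (filter (¬? ∘ z?) ys)
    -- `ys` is a sublist of `xs`, so it has no more neighbours of `z` than `xs` has.
    near≤d : near ≤ d
    near≤d = ≤-trans (length-mono-≤ (filter⁺ z? z? (λ where refl → id) ys⊆xs)) few

  module _ {l k} (H : Graph l) (alt : Alternating H) (l≤1+2k : l ≤ suc (2 * k)) where

    -- With `z` itself, `2 * k` successors make `2 * k + 1` independent vertices, enough for `H`;
    -- hence the bound `pred (2 * k)` otherwise.
    extend : ∀ {q z} (P : Path q) → z ∈ Path.rest P →
             (Path (suc q) ⊎ complement F Contains H)
             ⊎ length (filter (adjacent? F z) (Path.first P ∷ Path.tail P)) ≤ pred (2 * k)
    extend {q} {z} P z∈ with rest′ , p ← ∈⇒↭ z∈ = result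
      where
      open Path P

      partition′ : z ∷ first ∷ tail ++ rest′ ↭ allFin N
      partition′ = ↭-trans
        (↭-sym (↭-trans (++⁺ˡ (first ∷ tail) p) (shift z (first ∷ tail) rest′)))
        partition

      longer : Traceable (z ∷ first ∷ tail) → Path (suc q)
      longer (_ , _ , _ , w , p) = record
        { walk      = w
        ; partition = ↭-trans (++⁺ʳ rest′ p) partition′
        ; size      = trans (↭-length p) (cong suc size)
        }

      unique : Unique (z ∷ succs z first tail)
      unique = AllPairs-resp-⊆
        (refl ∷ first ∷ʳ ⊆-trans (succs-⊆ z first tail) (⊆-++⁺ʳ rest′ ⊆-refl))
        (unique-allFin partition′)

      result : _
      result with adjacent? F z last
      ... | yes zx = inj₁ (inj₁ (longer
              (_ , _ , _ , join walk (symmetric F zx) [] , ↭-sym (∷↭∷ʳ z (first ∷ tail)))))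
      ... | no ¬zx with insert [] walk
      ...   | inj₁ t   = inj₁ (inj₁ (longer t))
      ...   | inj₂ ind with 2 * k ≤? length (succs z first tail)
      ...     | yes big   = inj₁ (inj₂
              (independent⇒contains {k = k} H alt l≤1+2k (s≤s big) unique ind))
      ...     | no  small = inj₂
              (≤-trans (≤-reflexive (length-succs walk ¬zx)) (<⇒≤pred (≰⇒> small)))

    -- Since `q < n`, at least `k` vertices lie off the path. If none of `k` such vertices settles
    -- the matter through `extend`, together they exclude at most `k * pred (2 * k)` path vertices,
    -- and `large` leaves `k + 1`.
    grow : ∀ {n q} → suc N ≡ n + k → suc k + k * pred (2 * k) ≤ q → q < n →
           Path q → Path (suc q) ⊎ complement F Contains H
    grow {n} {q} N≡ large q<n P with all-or (All-take⁺ k (All.tabulate (extend P)))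
    ... | inj₁ outcome = outcome
    ... | inj₂ sparse
      with ys , ys⊆ , bound , nonadj ← common-nonneighbours (pred (2 * k)) _ sparse =
      inj₂ (biclique⇒contains H alt l≤1+2k record
        { left    = take k rest
        ; right   = ys
        ; a≤left  = ≤-reflexive (sym |left|≡k)
        ; b≤right = +-cancelʳ-≤ (k * pred (2 * k)) (suc k) (length ys) (begin
            suc k + k * pred (2 * k)                           ≤⟨ large ⟩
            q                                                  ≡⟨ size ⟨
            suc (length tail)                                  ≤⟨ bound ⟩
            length ys + length (take k rest) * pred (2 * k)
              ≡⟨ cong (λ m → length ys + m * pred (2 * k)) |left|≡k ⟩
            length ys + k * pred (2 * k)                       ∎)
        ; unique  = AllPairs-resp-⊆ (⊆-++⁺ (take-⊆ k rest) ys⊆)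
            (Unique-resp-↭ (++-comm (first ∷ tail) rest) (unique-allFin partition))
        ; nonAdj  = nonadj
        })
      where
      open Path P
      open ≤-Reasoning

      k≤|rest| : k ≤ length rest
      k≤|rest| = +-cancelˡ-≤ n k (length rest) (begin
        n + k                                  ≡⟨ N≡ ⟨
        suc N                                  ≡⟨ cong suc (length-allFin partition) ⟨
        suc (length (first ∷ tail ++ rest))    ≡⟨ cong suc (length-++ (first ∷ tail)) ⟩
        suc (suc (length tail) + length rest)  ≡⟨ cong (λ m → suc (m + length rest)) size ⟩
        suc q + length rest                    ≤⟨ +-monoˡ-≤ (length rest) q<n ⟩
        n + length rest                        ∎)

      |left|≡k : length (take k rest) ≡ k
      |left|≡k = trans (length-take k rest) (m≤n⇒m⊓n≡m k≤|rest|)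

    grow* : ∀ m {n q} → suc N ≡ n + k → suc k + k * pred (2 * k) ≤ q → m + q ≡ n →
            Path q → Path n ⊎ complement F Contains H
    grow* zero    N≡ large refl P = inj₁ P
    grow* (suc m) {n} {q} N≡ large eq P = [ continue , inj₂ ]′ (grow N≡ large q<n P)
      where
      eq′ : m + suc q ≡ n
      eq′ = trans (+-suc m q) eq

      q<n : q < n
      q<n = ≤-trans (m≤n+m (suc q) m) (≤-reflexive eq′)

      continue : Path (suc q) → Path n ⊎ complement F Contains H
      continue = grow* m N≡ (m≤n⇒m≤1+n large) eq′

-- The upper bound.

ramsey-upper : ∀ {l} k n N (H : Graph l) → Alternating H → l ≤ suc (2 * k) → 3 ≤ k →
               suc ((4 * k ∸ 1) * (k ∸ 1)) ≤ n → suc N ≡ n + k →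
               RamseyProperty (path n) H N
ramsey-upper (suc (suc zero)) _ _ _ _ _ (s≤s (s≤s ()))
ramsey-upper k@(suc (suc (suc t))) n N H alt l≤1+2k 3≤k n-large N≡ F =
  [ (λ P → ⊎-map₁ path⇒contains (
        grow* H alt l≤1+2k (n ∸ q₀) N≡ ≤-refl (m∸n+n≡m q₀≤n) P))
  , inj₂ ∘ biclique⇒contains H alt l≤1+2k
  ]′ (path-or-biclique {q₀} {k} (s≤s (s≤s z≤n)) (s≤s z≤n)
       (s≤s⁻¹ (≤-trans room (≤-reflexive (sym N≡)))))
  where
  open InGraph F
  open ≤-Reasoning
  q₀ = suc k + k * pred (2 * k)

  -- The search requires `q₀ + 2 * k ≤ N`; the shift by one comes from `suc N ≡ n + k`.
  room : suc (q₀ + 2 * k) ≤ n + k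
  room = begin
    suc (q₀ + 2 * k)                          ≤⟨ m≤m+n _ _ ⟩
    suc (q₀ + 2 * k) + (2 * t * t + 6 * t)    ≡⟨ slack t ⟩
    suc ((4 * k ∸ 1) * (k ∸ 1)) + k           ≤⟨ +-monoˡ-≤ k n-large ⟩
    n + k                                     ∎
    where
    -- With k = 3 + t the slack 2t² + 6t is a natural number; this is where k ≥ 3 is needed.
    slack : ∀ t → let k = 3 + t in
            suc (suc k + k * pred (2 * k) + 2 * k) + (2 * t * t + 6 * t)
            ≡ suc ((4 * k ∸ 1) * (k ∸ 1)) + k
    slack = solve 1 (λ t → let k = con 3 :+ t in
      con 1 :+ (con 1 :+ k :+ k :* (con 2 :+ t :+ (k :+ con 0)) :+ con 2 :* k)
        :+ (con 2 :* t :* t :+ con 6 :* t)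
      := con 1 :+ (con 2 :+ t :+ con 3 :* k) :* (con 2 :+ t) :+ k) refl

  q₀≤n : q₀ ≤ n
  q₀≤n = +-cancelʳ-≤ k q₀ n (begin
    q₀ + k            ≤⟨ +-monoʳ-≤ q₀ (m≤m+n k (k + 0)) ⟩
    q₀ + 2 * k        ≤⟨ n≤1+n _ ⟩
    suc (q₀ + 2 * k)  ≤⟨ room ⟩
    n + k             ∎)

-- The lower bound.

interval-size : ∀ {a M} (h : Fin a → Fin M) → Injective _≡_ _≡_ h → ∀ lo b →
                (∀ i → lo ≤ toℕ (h i)) → (∀ i → toℕ (h i) < lo + b) → a ≤ b
interval-size {a} h h-inj lo b lo≤h h<lo+b = injective⇒≤ g-injective
  where
  offset : ∀ i → toℕ (h i) ∸ lo < b
  offset i = subst (toℕ (h i) ∸ lo <_) (m+n∸m≡n lo b) (∸-monoˡ-< (h<lo+b i) (lo≤h i))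

  g : Fin a → Fin b
  g i = fromℕ< (offset i)

  g-injective : Injective _≡_ _≡_ g
  g-injective {i} {j} eq = h-inj (toℕ-injective (∸-cancelʳ-≡ (lo≤h i) (lo≤h j)
    (trans (sym (toℕ-fromℕ< (offset i))) (trans (cong toℕ eq) (toℕ-fromℕ< (offset j))))))

path-edge : ∀ {p} (i : Fin p) → Adj (path (suc p)) (inject₁ i) (suc i)
path-edge i =
  (λ eq → 1+n≢n (trans (sym (cong toℕ eq)) (toℕ-inject₁ i))) ,
  inj₁ (cong suc (sym (toℕ-inject₁ i)))

-- The vertices below `c` form one clique and the rest of `M` the other; `M` stays arbitrary so that
-- every order that is too small is refuted directly.
module TwoCliques (M c : ℕ) where

  SameSide : Rel (Fin M) 0ℓ
  SameSide i j = (toℕ i < c × toℕ j < c) ⊎ (c ≤ toℕ i × c ≤ toℕ j)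

  sameSide? : Decidable SameSide
  sameSide? i j = ((toℕ i <? c) ×-dec (toℕ j <? c)) ⊎-dec ((c ≤? toℕ i) ×-dec (c ≤? toℕ j))

  twoCliques : Graph M
  twoCliques = fromRel sameSide?

  low-step : ∀ {i j} → Adj twoCliques i j → toℕ i < c → toℕ j < c
  low-step (_ , inj₁ (inj₁ (_   , j<c))) _   = j<c
  low-step (_ , inj₁ (inj₂ (c≤i , _  ))) i<c = contradiction c≤i (<⇒≱ i<c)
  low-step (_ , inj₂ (inj₁ (j<c , _  ))) _   = j<c
  low-step (_ , inj₂ (inj₂ (_   , c≤i))) i<c = contradiction c≤i (<⇒≱ i<c)

  -- The side of the first vertex is inherited along the edges of the path, which therefore stays in
  -- one clique.
  path-bound : ∀ {p j} → M ≤ c + j → twoCliques Contains path (suc p) → suc p ≤ c ⊎ suc p ≤ j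
  path-bound {p} {j} M≤c+j (f , f-inj , f-hom) with toℕ (f zero) <? c
  ... | yes f₀<c = inj₁ (interval-size f f-inj 0 c (λ _ → z≤n)
    (<-weakInduction (λ i → toℕ (f i) < c) f₀<c λ i → low-step (f-hom (path-edge i))))
  ... | no f₀≮c = inj₂ (interval-size f f-inj c j
    (<-weakInduction (λ i → c ≤ toℕ (f i)) (≮⇒≥ f₀≮c)
      λ i c≤fi → ≮⇒≥ λ fi<c →
        <⇒≱ (low-step (symmetric twoCliques (f-hom (path-edge i))) fi<c) c≤fi)
    (λ i → <-≤-trans (toℕ<n (f i)) M≤c+j))

-- Indexing ends by `Fin 2` allows choosing one end per edge; `disjoint` makes every such choice
-- injective.
record Matching {l} (k : ℕ) (H : Graph l) : Set where
  field
    end      : Fin k → Fin 2 → Fin l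
    matched  : ∀ i → Adj H (end i zero) (end i (suc zero))
    disjoint : ∀ {i j b c} → end i b ≡ end j c → i ≡ j

module _ (M c : ℕ) where
  open TwoCliques M c

  -- Every edge of the complement has an end in the second clique.
  matching-bound : ∀ {l k j} {H : Graph l} → Matching k H → M ≤ c + j →
                   complement twoCliques Contains H → k ≤ j
  matching-bound {k = k} {j} μ M≤c+j (f , f-inj , f-hom) =
    interval-size (λ i → f (end i (side i))) (disjoint ∘ f-inj) c j high
      (λ i → <-≤-trans (toℕ<n _) M≤c+j)
    where
    open Matching μ
    choice : ∀ i → ∃ λ b → c ≤ toℕ (f (end i b))
    choice i with c ≤? toℕ (f (end i zero)) | c ≤? toℕ (f (end i (suc zero)))
    ... | yes p | _     = zero , p
    ... | no _  | yes p = suc zero , p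
    ... | no p  | no q  =
      let x≢y , ¬xy = f-hom (matched i) in
      contradiction (x≢y , inj₁ (inj₁ (≰⇒> p , ≰⇒> q))) ¬xy

    side : Fin k → Fin 2
    side = proj₁ ∘ choice

    high : ∀ i → c ≤ toℕ (f (end i (side i)))
    high = proj₂ ∘ choice

-- Here `suc c` is the order of the path. If `M < c + suc k`, the second clique has at most `k`
-- vertices: too few for `suc k` matching edges and, as `suc k ≤ suc c`, too few for the path.
ramsey-lower : ∀ {l c k} {H : Graph l} → Matching (suc k) H → suc k ≤ suc c →
               ∀ M → RamseyProperty (path (suc c)) H M → c + suc k ≤ M
ramsey-lower {c = c} {k} μ k≤c M ramsey = ≮⇒≥ λ M<c+k →
  let M≤c+k = s≤s⁻¹ (≤-trans M<c+k (≤-reflexive (+-suc c k))) in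
  case ramsey twoCliques of λ where
    (inj₁ p) → [ 1+n≰n , (λ 1+c≤k → 1+n≰n (≤-trans k≤c 1+c≤k)) ]′ (path-bound M≤c+k p)
    (inj₂ h) → 1+n≰n (matching-bound M c μ M≤c+k h)
  where open TwoCliques M c

-- Two-colouring and matching of the Jahangir graph.

even⇒parity≡0 : ∀ {n} → 2 ∣ n → parity n ≡ 0ℙ
even⇒parity≡0 (divides q refl) = trans (*-homo-* q 2) (ℙ-*-zeroʳ (parity q))

module _ {s m : ℕ} where
  open Jahangir s m

  -- The hub has number 0, and spokes end at cycle indices divisible by `s`, hence at odd vertex
  -- numbers, which are one larger.
  jahangir-alternating : 2 ∣ s → Alternating (jahangir s m)
  jahangir-alternating 2∣s = alternating
    where
    odd : ∀ {n} → 2 ∣ n → parity (suc n) ≢ 0ℙ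
    odd {n} 2∣n eq = parity-suc n (trans eq (sym (even⇒parity≡0 2∣n)))

    spoke-odd : ∀ {i : Fin (s * m)} → Spoke i → parity (suc (toℕ i)) ≢ 0ℙ
    spoke-odd {i} (k , eq) = odd (subst (2 ∣_) (sym eq) (∣n⇒∣m*n (toℕ k) 2∣s))

    rim : ∀ {i j : Fin (s * m)} →
          toℕ j ≡ suc (toℕ i) ⊎ (suc (toℕ i) ≡ s * m × toℕ j ≡ 0) →
          parity (suc (toℕ i)) ≢ parity (suc (toℕ j))
    rim {i} (inj₁ eq) rewrite eq = ≢-sym (parity-suc (suc (toℕ i)))
    -- The closing edge of the cycle joins the even number `s * m` to 1.
    rim (inj₂ (eq , eq₀)) rewrite eq | eq₀ | even⇒parity≡0 (∣m⇒∣m*n m 2∣s) = λ ()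

    alternating : Alternating (jahangir s m)
    alternating zero    (suc j) e = ≢-sym (spoke-odd e)
    alternating (suc i) zero    e = spoke-odd e
    alternating (suc i) (suc j) (_ , inj₁ e) = rim e
    alternating (suc i) (suc j) (_ , inj₂ e) = ≢-sym (rim e)

  -- Every other edge of the cycle is taken: `combine i b` is `2 * i + b`.
  jahangir-matching : ∀ {k} → k * 2 ≡ s * m → Matching k (jahangir s m)
  jahangir-matching {k} eq = record
    { end      = λ i b → suc (rim i b)
    ; matched  = λ i → (λ e → 1+n≢n (sym (trans (cong toℕ e) (consecutive i)))) ,
                       inj₁ (inj₁ (consecutive i))
    ; disjoint = λ {i} {j} {b} {c} e → combine-injectiveˡ i b j c
        (toℕ-injective (trans (sym (toℕ-cast eq _))
          (trans (cong toℕ (sucᶠ-injective e)) (toℕ-cast eq _))))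
    }
    where
    rim : Fin k → Fin 2 → Fin (s * m)
    rim i b = cast eq (combine i b)

    toℕ-rim : ∀ i b → toℕ (rim i b) ≡ 2 * toℕ i + toℕ b
    toℕ-rim i b = trans (toℕ-cast eq _) (toℕ-combine i b)

    consecutive : ∀ i → toℕ (rim i (suc zero)) ≡ suc (toℕ (rim i zero))
    consecutive i = trans (toℕ-rim i (suc zero)) (trans (+-suc _ 0) (cong suc (sym (toℕ-rim i zero))))

theorem1 : ∀ (s m n : ℕ) → s ≥ 2 → 2 ∣ s → m ≥ 3 →
    n ≥ (2 * s * m ∸ 1) * (s * m / 2 ∸ 1) + 1 →
    IsRamseyNumber (path n) (jahangir s m) (n + s * m / 2 ∸ 1)
theorem1 s m n s≥2 2∣s m≥3 n≥ = result (s * m / 2) n k*2≡sm 3≤k bound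
  where
  k*2≡sm : s * m / 2 * 2 ≡ s * m
  k*2≡sm = m/n*n≡m (∣m⇒∣m*n m 2∣s)

  3≤k : 3 ≤ s * m / 2
  3≤k = *-cancelʳ-≤ 3 _ 2 (≤-trans (*-mono-≤ s≥2 m≥3) (≤-reflexive (sym k*2≡sm)))

  2sm≡4k : 2 * s * m ≡ 4 * (s * m / 2)
  2sm≡4k = trans (*-assoc 2 s m) (trans (cong (2 *_) (sym k*2≡sm))
    (solve 1 (λ k → con 2 :* (k :* con 2) := con 4 :* k) refl (s * m / 2)))

  bound : suc ((4 * (s * m / 2) ∸ 1) * (s * m / 2 ∸ 1)) ≤ n
  bound = subst (λ e → suc ((e ∸ 1) * (s * m / 2 ∸ 1)) ≤ n) 2sm≡4k
                (≤-trans (≤-reflexive (+-comm 1 _)) n≥)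

  -- Abstracting `s * m / 2` and `n` lets both be matched as successors, so that `n + k ∸ 1` reduces
  -- to `c + k`.
  result : ∀ k n → k * 2 ≡ s * m → 3 ≤ k → suc ((4 * k ∸ 1) * (k ∸ 1)) ≤ n →
           IsRamseyNumber (path n) (jahangir s m) (n + k ∸ 1)
  result (suc (suc zero)) _ _ (s≤s (s≤s ()))
  result k@(suc j@(suc (suc _))) n@(suc c) eq 3≤k bound =
    ramsey-upper k n (c + k) (jahangir s m) (jahangir-alternating 2∣s)
      (s≤s (≤-reflexive (trans (sym eq) (*-comm k 2)))) 3≤k bound refl ,
    -- The bound on `n` yields `k ≤ n` because `4 * k ∸ 1` is positive.
    ramsey-lower (jahangir-matching eq) (≤-trans (s≤s (m≤n*m j (4 * k ∸ 1))) bound)
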